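{- Let $T$ be a complete first-order theory. If $T$ is weakly o-minimal, then $T$ is fully VC-minimal.
   Context: $\mathfrak{C}$ denotes a monster model of $T$. "Formula" means a formula without parameters; $x$ denotes a single variable, $\overline{y}$ a finite tuple of variables, $\mathrm{lg}(\overline{y})$ its length. Weakly o-minimal: the language contains a symbol $<$ interpreted as a linear order, and in every model of $T$ every subset of the universe definable with parameters is a finite union of $<$-convex sets. Independence dimension $\le 1$: a family $\mathcal{A}$ of subsets of a set $X$ has independence dimension $\le 1$ with respect to $X$ if there are no two distinct $B_0, B_1 \in \mathcal{A}$ such that all four sets $B_0^{s} \cap B_1^{t}$ ($s,t \in \{0,1\}$) are nonempty, where $B^1 = B$ and $B^0 = X \setminus B$. Fully VC-minimal: $T$ is fully VC-minimal if there is a family of formulas $\Psi$, each of which has at least $x$ as a free variable (possibly as a dummy variable), such that: (i) the set $\mathcal{A}_\Psi = \{\psi(\mathfrak{C};\overline{b}) : \psi(x;\overline{y}) \in \Psi, \overline{b} \in \mathfrak{C}^{\mathrm{lg}(\overline{y})}\}$ has independence dimension $\le 1$ with respect to $\mathfrak{C}$; and (ii) for every formula $\varphi(x;\overline{y})$ there is a boolean combination $\psi(x;\overline{y})$ of formulas from $\Psi$ with variables $(x;\overline{y})$ such that $\varphi(x;\overline{y})$ is $T$-equivalent to $\psi(x;\overline{y})$. -}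

module Defs where

open import Level using (Level; suc)
open import Data.Bool.Base using (Bool; true; false)
open import Data.Fin.Base using (Fin)
open import Data.List.Base using (List)
open import Data.List.Relation.Unary.All using (All)
open import Data.Nat.Base as ℕ using (ℕ)
open import Data.Product.Base using (Σ; ∃; ∃-syntax; Σ-syntax; _×_; _,_)
open import Data.Sum.Base using (_⊎_)
open import Data.Vec.Base using (Vec; []; _∷_; lookup; map; _++_)
open import Function.Bundles using (_⇔_; _↔_; _↣_; module Inverse)
open import Relation.Binary.Core using (Rel)
open import Relation.Binary.PropositionalEquality.Core using (_≡_)
open import Relation.Binary.Structures using (IsStrictTotalOrder)
open import Relation.Nullary.Negation.Core using (¬_)
open import Relation.Unary using (Pred; _∈_; _≐_; _∩_; ∁; ⋃; Satisfiable)

------------------------------------------------------------------------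
-- First-order syntax

record Language (ℓ : Level) : Set (suc ℓ) where
  field
    FunSym : ℕ → Set ℓ
    RelSym : ℕ → Set ℓ

open Language public

data Term {ℓ : Level} (L : Language ℓ) (n : ℕ) : Set ℓ where
  var : Fin n → Term L n
  fun : ∀ {k} → FunSym L k → Vec (Term L n) k → Term L n

-- Formulas whose free variables are among n given ones (de Bruijn
-- indices; a quantifier binds index 0).  Variables that do not occur are
-- dummy variables.  A formula φ(x;ȳ) with lg(ȳ) = m is an element of
-- Formula L (1 + m), with x at index 0.

infix  9 _≈ᶠ_
infixr 7 _∧ᶠ_
infixr 6 _∨ᶠ_

data Formula {ℓ : Level} (L : Language ℓ) : ℕ → Set ℓ where
  _≈ᶠ_ : ∀ {n} → Term L n → Term L n → Formula L n
  rel  : ∀ {n k} → RelSym L k → Vec (Term L n) k → Formula L n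
  ¬ᶠ_  : ∀ {n} → Formula L n → Formula L n
  _∧ᶠ_ : ∀ {n} → Formula L n → Formula L n → Formula L n
  _∨ᶠ_ : ∀ {n} → Formula L n → Formula L n → Formula L n
  ∀ᶠ_  : ∀ {n} → Formula L (1 ℕ.+ n) → Formula L n
  ∃ᶠ_  : ∀ {n} → Formula L (1 ℕ.+ n) → Formula L n

Sentence : {ℓ : Level} → Language ℓ → Set ℓ
Sentence L = Formula L 0

------------------------------------------------------------------------
-- Structures and satisfaction

record Structure {ℓ : Level} (L : Language ℓ) : Set (suc ℓ) where
  field
    Carrier  : Set ℓ
    nonempty : Carrier
    funᴵ     : ∀ {k} → FunSym L k → Vec Carrier k → Carrier
    relᴵ     : ∀ {k} → RelSym L k → Pred (Vec Carrier k) ℓ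

open Structure public using (Carrier; funᴵ; relᴵ)

module _ {ℓ : Level} {L : Language ℓ} (M : Structure L) where

  mutual
    eval : ∀ {n} → Term L n → Vec (Carrier M) n → Carrier M
    eval (var i)    v = lookup v i
    eval (fun f ts) v = funᴵ M f (evals ts v)

    evals : ∀ {n k} → Vec (Term L n) k → Vec (Carrier M) n → Vec (Carrier M) k
    evals []       v = []
    evals (t ∷ ts) v = eval t v ∷ evals ts v

  infix 4 _⊨_[_]

  _⊨_[_] : ∀ {n} → Formula L n → Vec (Carrier M) n → Set ℓ
  _⊨_[_] (s ≈ᶠ t)   v = eval s v ≡ eval t v
  _⊨_[_] (rel R ts) v = relᴵ M R (evals ts v)
  _⊨_[_] (¬ᶠ φ)     v = ¬ _⊨_[_] φ v
  _⊨_[_] (φ ∧ᶠ ψ)   v = _⊨_[_] φ v × _⊨_[_] ψ v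
  _⊨_[_] (φ ∨ᶠ ψ)   v = _⊨_[_] φ v ⊎ _⊨_[_] ψ v
  _⊨_[_] (∀ᶠ φ)     v = ∀ a → _⊨_[_] φ (a ∷ v)
  _⊨_[_] (∃ᶠ φ)     v = ∃[ a ] _⊨_[_] φ (a ∷ v)

-- The subset φ(M;b̄) of the universe.

⟦_⟧ : {ℓ : Level} {L : Language ℓ} {m : ℕ} → Formula L (1 ℕ.+ m) →
      (M : Structure L) → Vec (Carrier M) m → Pred (Carrier M) ℓ
⟦ φ ⟧ M b a = M ⊨ φ [ a ∷ b ]

-- Definable with parameters.

Definable : {ℓ : Level} {L : Language ℓ} (M : Structure L) → Pred (Pred (Carrier M) ℓ) ℓ
Definable {L = L} M S =
  ∃[ m ] Σ[ φ ∈ Formula L (1 ℕ.+ m) ] Σ[ b ∈ Vec (Carrier M) m ] S ≐ ⟦ φ ⟧ M b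

------------------------------------------------------------------------
-- Theories

Theory : {ℓ : Level} → Language ℓ → Set (suc ℓ)
Theory {ℓ} L = Pred (Sentence L) ℓ

module _ {ℓ : Level} {L : Language ℓ} where

  infix 4 _⊨ᵀ_ _⊩_

  _⊨ᵀ_ : Structure L → Theory L → Set ℓ
  M ⊨ᵀ T = ∀ σ → σ ∈ T → M ⊨ σ [ [] ]

  _⊩_ : Theory L → Sentence L → Set (suc ℓ)
  T ⊩ σ = ∀ M → M ⊨ᵀ T → M ⊨ σ [ [] ]

  Complete : Theory L → Set (suc ℓ)
  Complete T = (∃[ M ] M ⊨ᵀ T) × (∀ σ → T ⊩ σ ⊎ T ⊩ ¬ᶠ σ)

  Equivalent : Theory L → ∀ {n} → Formula L n → Formula L n → Set (suc ℓ)
  Equivalent T φ ψ = ∀ M → M ⊨ᵀ T → ∀ v → M ⊨ φ [ v ] ⇔ M ⊨ ψ [ v ]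

------------------------------------------------------------------------
-- Monster models

-- Strict inequality of cardinalities.

_≺_ : {ℓ : Level} → Set ℓ → Set ℓ → Set ℓ
I ≺ K = (I ↣ K) × ¬ (K ↣ I)

module _ {ℓ : Level} {L : Language ℓ} (M : Structure L) where

  -- Parameter sets of cardinality < κ are given as families a : I → Carrier M
  -- with I ≺ κ.  A formula in n variables with parameters from the family
  -- is a formula in n + m variables, the last m of which stand for members
  -- of the family.

  ParamFormula : Set ℓ → ℕ → Set ℓ
  ParamFormula I n = ∃[ m ] (Formula L (n ℕ.+ m) × Vec I m)

  Holds : {I : Set ℓ} (a : I → Carrier M) {n : ℕ} →
          ParamFormula I n → Vec (Carrier M) n → Set ℓ
  Holds a (m , φ , js) c = M ⊨ φ [ c ++ map a js ]

  FinitelySatisfiable : {I : Set ℓ} (a : I → Carrier M) {n : ℕ} →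
                        Pred (ParamFormula I n) ℓ → Set ℓ
  FinitelySatisfiable a p =
    ∀ φs → All p φs → ∃[ c ] All (λ φ → Holds a φ c) φs

  Realized : {I : Set ℓ} (a : I → Carrier M) {n : ℕ} →
             Pred (ParamFormula I n) ℓ → Set ℓ
  Realized a p = ∃[ c ] (∀ φ → φ ∈ p → Holds a φ c)

  Saturated : Set ℓ → Set (suc ℓ)
  Saturated κ = ∀ {I : Set ℓ} → I ≺ κ → (a : I → Carrier M) →
    ∀ {n} (p : Pred (ParamFormula I n) ℓ) → FinitelySatisfiable a p → Realized a p

  record Automorphism : Set ℓ where
    field
      bijection : Carrier M ↔ Carrier M

    open Inverse bijection public using (to)

    field
      preserves-fun : ∀ {k} (f : FunSym L k) v → to (funᴵ M f v) ≡ funᴵ M f (map to v)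
      preserves-rel : ∀ {k} (R : RelSym L k) v → relᴵ M R v ⇔ relᴵ M R (map to v)

  -- The assignment a i ↦ b i is an elementary map.

  Elementary : {I : Set ℓ} → Rel (I → Carrier M) ℓ
  Elementary {I} a b = ∀ {m} (φ : Formula L m) (js : Vec I m) →
    M ⊨ φ [ map a js ] ⇔ M ⊨ φ [ map b js ]

  StronglyHomogeneous : Set ℓ → Set (suc ℓ)
  StronglyHomogeneous κ = ∀ {I : Set ℓ} → I ≺ κ → (a b : I → Carrier M) →
    Elementary a b → Σ[ σ ∈ Automorphism ] (∀ i → Automorphism.to σ (a i) ≡ b i)

-- A κ-saturated and strongly κ-homogeneous model for some κ exceeding the
-- cardinality of the theory (the number of formulas, |L| + ℵ₀).

record Monster {ℓ : Level} {L : Language ℓ} (T : Theory L) (ℭ : Structure L) : Set (suc ℓ) where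
  field
    isModel             : ℭ ⊨ᵀ T
    κ                   : Set ℓ
    large               : ∃ (Formula L) ≺ κ
    saturated           : Saturated ℭ κ
    stronglyHomogeneous : StronglyHomogeneous ℭ κ

------------------------------------------------------------------------
-- Weak o-minimality

Convex : {ℓ : Level} {A : Set ℓ} → Rel A ℓ → Pred (Pred A ℓ) ℓ
Convex _<_ S = ∀ {a b c} → a ∈ S → c ∈ S → a < b → b < c → b ∈ S

FiniteUnionOfConvex : {ℓ : Level} {A : Set ℓ} → Rel A ℓ → Pred (Pred A ℓ) (suc ℓ)
FiniteUnionOfConvex {ℓ} {A} _<_ S =
  ∃[ k ] Σ[ C ∈ (Fin k → Pred A ℓ) ] (∀ i → Convex _<_ (C i)) × S ≐ ⋃ (Fin k) C

WeaklyOMinimal : {ℓ : Level} {L : Language ℓ} → Theory L → Set (suc ℓ)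
WeaklyOMinimal {L = L} T = Σ[ lt ∈ RelSym L 2 ] (∀ M → M ⊨ᵀ T →
  let _<_ : Rel (Carrier M) _
      a < b = relᴵ M lt (a ∷ b ∷ [])
  in IsStrictTotalOrder _≡_ _<_ × (∀ S → Definable M S → FiniteUnionOfConvex _<_ S))

------------------------------------------------------------------------
-- Full VC-minimality

infixl 30 _^_

_^_ : {ℓ : Level} {X : Set ℓ} → Pred X ℓ → Bool → Pred X ℓ
B ^ true  = B
B ^ false = ∁ B

IndependenceDimension≤1 : {ℓ : Level} {X : Set ℓ} → Pred (Pred X ℓ) ℓ → Set (suc ℓ)
IndependenceDimension≤1 𝒜 =
  ¬ (∃[ B₀ ] ∃[ B₁ ] B₀ ∈ 𝒜 × B₁ ∈ 𝒜 × ¬ (B₀ ≐ B₁) ×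
     (∀ s t → Satisfiable (B₀ ^ s ∩ B₁ ^ t)))

module _ {ℓ : Level} {L : Language ℓ} where

  Family : Set (suc ℓ)
  Family = ∀ {m} → Pred (Formula L (1 ℕ.+ m)) ℓ

  Instances : Family → (ℭ : Structure L) → Pred (Pred (Carrier ℭ) ℓ) ℓ
  Instances Ψ ℭ B =
    ∃[ m ] Σ[ ψ ∈ Formula L (1 ℕ.+ m) ] (ψ ∈ Ψ × Σ[ b ∈ Vec (Carrier ℭ) m ] B ≐ ⟦ ψ ⟧ ℭ b)

  data BooleanCombination (Ψ : Family) {m : ℕ} : Pred (Formula L (1 ℕ.+ m)) ℓ where
    atom : ∀ {ψ} → ψ ∈ Ψ → BooleanCombination Ψ ψ
    neg  : ∀ {ψ} → BooleanCombination Ψ ψ → BooleanCombination Ψ (¬ᶠ ψ)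
    conj : ∀ {ψ χ} → BooleanCombination Ψ ψ → BooleanCombination Ψ χ →
           BooleanCombination Ψ (ψ ∧ᶠ χ)
    disj : ∀ {ψ χ} → BooleanCombination Ψ ψ → BooleanCombination Ψ χ →
           BooleanCombination Ψ (ψ ∨ᶠ χ)

  FullyVCMinimal : Theory L → Structure L → Set (suc ℓ)
  FullyVCMinimal T ℭ = Σ[ Ψ ∈ Family ]
    IndependenceDimension≤1 (Instances Ψ ℭ) ×
    (∀ {m} (φ : Formula L (1 ℕ.+ m)) →
       Σ[ ψ ∈ Formula L (1 ℕ.+ m) ] (BooleanCombination Ψ ψ × Equivalent T φ ψ))

{-# OPTIONS --safe #-}

-- Any two up-closed subsets of a linear order are comparable under inclusion,
-- so the formulas all of whose instances are up-closed form a family of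
-- independence dimension ≤ 1.  Given φ(x;ȳ), let Aₖ(x;ȳ) say that some
-- z₁ ≤ … ≤ zₖ ≤ x lie alternately inside and outside φ(–;ȳ), starting inside;
-- Aₖ is up-closed in x.  A union of k convex sets admits no alternation of
-- length 2k + 1, so by saturation the length of the alternations is bounded
-- uniformly in ȳ, and completeness carries the bound to all models of T.
-- A point x is in φ exactly if the maximal k with Aₖ(x) is odd, whence φ is
-- A₁ ∧ ¬ (A₂ ∧ ¬ (A₃ ∧ …)), a nesting that stops at the bound.

module Submission where

open import Defs
open import Axiom.ExcludedMiddle using (ExcludedMiddle)
open import Data.Bool.Base using (true; false)
open import Data.Empty.Polymorphic using (⊥; ⊥-elim)
open import Data.Fin.Base using (Fin; zero; suc; lift; punchIn; punchOut)
open import Data.Fin.Properties using (punchIn-punchOut)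
open import Data.List.Relation.Unary.All using (All; []; _∷_)
open import Data.Nat.Base using (ℕ; zero; suc; _+_; _*_; _⊔_; _≤′_; ≤′-refl; ≤′-step)
import Data.Nat.Properties as ℕ
open import Data.Product.Base as Product using (Σ-syntax; ∃; ∃-syntax; _×_; _,_; proj₁; proj₂)
open import Data.Product.Function.NonDependent.Propositional using (_×-⇔_)
open import Data.Sum.Base using (inj₁; inj₂)
open import Data.Sum.Function.Propositional using (_⊎-⇔_)
open import Data.Unit.Polymorphic using (⊤; tt)
open import Data.Vec.Base using (Vec; []; _∷_; lookup; _++_; cast)
open import Data.Vec.Properties using (cast-is-id; ++-identityʳ-eqFree)
open import Function.Base using (_∘_; id)
open import Function.Bundles using (_⇔_; mk⇔; module Equivalence; module Injection)
open import Function.Properties.Equivalence using (⇔-isEquivalence)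
open import Level using (Level)
open import Relation.Binary.Core using (Rel)
open import Relation.Binary.Definitions using (tri<; tri≈; tri>)
import Relation.Binary.Construct.StrictToNonStrict as StrictToNonStrict
open import Relation.Binary.PropositionalEquality
  using (_≡_; refl; sym; cong; cong₂; subst; isEquivalence; resp₂)
open import Relation.Binary.Structures using (IsStrictTotalOrder; IsEquivalence)
open import Relation.Nullary.Decidable using (yes; no; decidable-stable)
open import Relation.Nullary.Negation using (¬_; contradiction)
open import Relation.Unary using (Pred; _∈_; _∉_; _⊆_; ∁; ⋃)

open Equivalence using (to; from)

-- Congruence of logical equivalence

private
  variable
    ℓ : Level
    L : Language ℓ
    k m n : ℕ

  ⇔-refl : {A : Set ℓ} → A ⇔ A
  ⇔-refl = IsEquivalence.refl ⇔-isEquivalence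

  ⇔-trans : {A B C : Set ℓ} → A ⇔ B → B ⇔ C → A ⇔ C
  ⇔-trans = IsEquivalence.trans ⇔-isEquivalence

  ≡⇒⇔ : {A B : Set ℓ} → A ≡ B → A ⇔ B
  ≡⇒⇔ refl = ⇔-refl

  ¬-⇔ : {A B : Set ℓ} → A ⇔ B → (¬ A) ⇔ (¬ B)
  ¬-⇔ A⇔B = mk⇔ (_∘ from A⇔B) (_∘ to A⇔B)

  ∀-⇔ : {A : Set ℓ} {P Q : Pred A ℓ} → (∀ a → P a ⇔ Q a) → (∀ a → P a) ⇔ (∀ a → Q a)
  ∀-⇔ P⇔Q = mk⇔ (λ p a → to (P⇔Q a) (p a)) (λ q a → from (P⇔Q a) (q a))

  ∃-⇔ : {A : Set ℓ} {P Q : Pred A ℓ} → (∀ a → P a ⇔ Q a) → ∃ P ⇔ ∃ Q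
  ∃-⇔ P⇔Q = mk⇔ (Product.map₂ (to (P⇔Q _))) (Product.map₂ (from (P⇔Q _)))

-- Renaming of variables

mutual
  renameᵗ : (Fin m → Fin n) → Term L m → Term L n
  renameᵗ ρ (var i)    = var (ρ i)
  renameᵗ ρ (fun f ts) = fun f (renameᵗˢ ρ ts)

  renameᵗˢ : (Fin m → Fin n) → Vec (Term L m) k → Vec (Term L n) k
  renameᵗˢ ρ []       = []
  renameᵗˢ ρ (t ∷ ts) = renameᵗ ρ t ∷ renameᵗˢ ρ ts

rename : (Fin m → Fin n) → Formula L m → Formula L n
rename ρ (s ≈ᶠ t)   = renameᵗ ρ s ≈ᶠ renameᵗ ρ t
rename ρ (rel R ts) = rel R (renameᵗˢ ρ ts)
rename ρ (¬ᶠ φ)     = ¬ᶠ rename ρ φ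
rename ρ (φ ∧ᶠ ψ)   = rename ρ φ ∧ᶠ rename ρ ψ
rename ρ (φ ∨ᶠ ψ)   = rename ρ φ ∨ᶠ rename ρ ψ
rename ρ (∀ᶠ φ)     = ∀ᶠ rename (lift 1 ρ) φ
rename ρ (∃ᶠ φ)     = ∃ᶠ rename (lift 1 ρ) φ

module _ {L : Language ℓ} (M : Structure L) where

  mutual
    eval-rename : ∀ {ρ : Fin m → Fin n} {v w} → (∀ i → lookup w (ρ i) ≡ lookup v i) →
                  ∀ (t : Term L m) → eval M (renameᵗ ρ t) w ≡ eval M t v
    eval-rename eq (var i)    = eq i
    eval-rename eq (fun f ts) = cong (funᴵ M f) (evals-rename eq ts)

    evals-rename : ∀ {ρ : Fin m → Fin n} {v w} → (∀ i → lookup w (ρ i) ≡ lookup v i) →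
                   ∀ (ts : Vec (Term L m) k) → evals M (renameᵗˢ ρ ts) w ≡ evals M ts v
    evals-rename eq []       = refl
    evals-rename eq (t ∷ ts) = cong₂ _∷_ (eval-rename eq t) (evals-rename eq ts)

  lookup-lift : ∀ {ρ : Fin m → Fin n} {v w} → (∀ i → lookup w (ρ i) ≡ lookup v i) →
                ∀ (a : Carrier M) i → lookup (a ∷ w) (lift 1 ρ i) ≡ lookup (a ∷ v) i
  lookup-lift eq a zero    = refl
  lookup-lift eq a (suc i) = eq i

  ⊨-rename : ∀ {ρ : Fin m → Fin n} {v w} → (∀ i → lookup w (ρ i) ≡ lookup v i) →
             ∀ (φ : Formula L m) → M ⊨ rename ρ φ [ w ] ⇔ M ⊨ φ [ v ]
  ⊨-rename eq (s ≈ᶠ t)   = ≡⇒⇔ (cong₂ _≡_ (eval-rename eq s) (eval-rename eq t))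
  ⊨-rename eq (rel R ts) = ≡⇒⇔ (cong (relᴵ M R) (evals-rename eq ts))
  ⊨-rename eq (¬ᶠ φ)     = ¬-⇔ (⊨-rename eq φ)
  ⊨-rename eq (φ ∧ᶠ ψ)   = ⊨-rename eq φ ×-⇔ ⊨-rename eq ψ
  ⊨-rename eq (φ ∨ᶠ ψ)   = ⊨-rename eq φ ⊎-⇔ ⊨-rename eq ψ
  ⊨-rename eq (∀ᶠ φ)     = ∀-⇔ λ a → ⊨-rename (lookup-lift eq a) φ
  ⊨-rename eq (∃ᶠ φ)     = ∃-⇔ λ a → ⊨-rename (lookup-lift eq a) φ

  ⊨-subst : (eq : n ≡ m) (φ : Formula L m) (v : Vec (Carrier M) n) →
            M ⊨ subst (Formula L) (sym eq) φ [ v ] ⇔ M ⊨ φ [ cast eq v ]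
  ⊨-subst refl φ v = ≡⇒⇔ (cong (M ⊨ φ [_]) (sym (cast-is-id refl v)))

-- Universal closure and completeness

∀ᶠ* : Formula L n → Sentence L
∀ᶠ* {n = zero}  φ = φ
∀ᶠ* {n = suc n} φ = ∀ᶠ* (∀ᶠ φ)

⊨-∀ᶠ* : {L : Language ℓ} (M : Structure L) (φ : Formula L n) →
        M ⊨ ∀ᶠ* φ [ [] ] ⇔ (∀ v → M ⊨ φ [ v ])
⊨-∀ᶠ* {n = zero}  M φ = mk⇔ (λ { p [] → p }) (λ p → p [])
⊨-∀ᶠ* {n = suc n} M φ = ⇔-trans (⊨-∀ᶠ* M (∀ᶠ φ))
  (mk⇔ (λ { p (a ∷ v) → p v a }) (λ p v a → p (a ∷ v)))

-- Validity in a model is truth of one sentence, the universal closure. `T` decides it, and `M`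
-- rules out its negation.
complete-transfer : {L : Language ℓ} {T : Theory L} → Complete T →
  ∀ {M N : Structure L} → M ⊨ᵀ T → N ⊨ᵀ T →
  (φ : Formula L n) → (∀ v → M ⊨ φ [ v ]) → ∀ v → N ⊨ φ [ v ]
complete-transfer (_ , decide) {M} {N} M⊨T N⊨T φ valid with decide (∀ᶠ* φ)
... | inj₁ T⊩φ  = to (⊨-∀ᶠ* N φ) (T⊩φ N N⊨T)
... | inj₂ T⊩¬φ = contradiction (from (⊨-∀ᶠ* M φ) valid) (T⊩¬φ M M⊨T)

-- Saturation for sequences of formulas

-- Initial segments suffice, as every finite part of a sequence lies in one.
FinitelySatisfiableᶠ : {L : Language ℓ} (M : Structure L) → (ℕ → Formula L n) → Set ℓ
FinitelySatisfiableᶠ M φ = ∀ k → ∃[ c ] (∀ {j} → j ≤′ k → M ⊨ φ j [ c ])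

monster-realizes : {L : Language ℓ} {T : Theory L} {ℭ : Structure L} → Monster T ℭ →
  (φ : ℕ → Formula L n) → FinitelySatisfiableᶠ ℭ φ → ∃[ c ] (∀ k → ℭ ⊨ φ k [ c ])
monster-realizes {ℓ = ℓ} {n = n} {L = L} {ℭ = ℭ} monster φ finSat =
  Product.map₂ (λ real k → to (holds k) (real (formula k) (k , refl)))
    (saturated ⊥≺κ (λ ()) type typeFinSat)
  where
  open Monster monster

  ⊥≺κ : ⊥ {ℓ} ≺ κ
  ⊥≺κ = record { to = λ () ; cong = λ { {()} } ; injective = λ { {()} } }
      -- `κ` is inhabited: it contains the image of a formula under `large`.
      , λ κ↣⊥ → ⊥-elim (Injection.to κ↣⊥
          (Injection.to (proj₁ large) (1 , var zero ≈ᶠ var zero)))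

  -- Without parameters a `ParamFormula` still has `n + 0` variables, hence the transport.
  formula : ℕ → ParamFormula ℭ ⊥ n
  formula k = 0 , subst (Formula L) (sym (ℕ.+-identityʳ n)) (φ k) , []

  holds : ∀ k {c} → Holds ℭ (λ ()) (formula k) c ⇔ ℭ ⊨ φ k [ c ]
  holds k {c} = ⇔-trans (⊨-subst ℭ (ℕ.+-identityʳ n) (φ k) (c ++ []))
    (≡⇒⇔ (cong (ℭ ⊨ φ k [_]) (++-identityʳ-eqFree c)))

  type : Pred (ParamFormula ℭ ⊥ n) ℓ
  type ψ = ∃[ k ] ψ ≡ formula k

  -- A finite part of the type mentions finitely many indices; `k` is their maximum.
  bounded : ∀ {ψs} → All type ψs →
    ∃[ k ] (∀ {c} → (∀ {j} → j ≤′ k → ℭ ⊨ φ j [ c ]) → All (λ ψ → Holds ℭ (λ ()) ψ c) ψs)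
  bounded [] = 0 , λ _ → []
  bounded ((j , refl) ∷ ps) with bounded ps
  ... | k , hold = j ⊔ k , λ sat →
    from (holds j) (sat (ℕ.≤⇒≤′ (ℕ.m≤m⊔n j k))) ∷
    hold (λ i≤k → sat (ℕ.≤⇒≤′ (ℕ.≤-trans (ℕ.≤′⇒≤ i≤k) (ℕ.m≤n⊔m j k))))

  typeFinSat : FinitelySatisfiable ℭ (λ ()) type
  typeFinSat ψs ps with bounded ps
  ... | k , hold = Product.map₂ hold (finSat k)

-- Alternations

∁^ : {A : Set ℓ} → ℕ → Pred A ℓ → Pred A ℓ
∁^ zero    S = S
∁^ (suc k) S = ∁ (∁^ k S)

module _ {A : Set ℓ} (_<_ : Rel A ℓ) where

  open StrictToNonStrict _≡_ _<_ using (_≤_) renaming (trans to mk≤-trans)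

  UpClosed : Pred (Pred A ℓ) ℓ
  UpClosed S = ∀ {a b} → a < b → a ∈ S → b ∈ S

  -- The chain is listed from the top, but parity is counted from the bottom, so dropping the top
  -- point leaves an alternation. The weak inequality allows `x` itself as top point.
  Alternation : Pred A ℓ → ℕ → Pred A ℓ
  Alternation S zero    x = ⊤
  Alternation S (suc k) x = ∃[ z ] (z ≤ x × ∁^ k S z × Alternation S k z)

  convex-≤ : ∀ {S a b c} → Convex _<_ S → a ∈ S → c ∈ S → a ≤ b → b ≤ c → b ∈ S
  convex-≤ convex a∈S c∈S (inj₁ a<b)  (inj₁ b<c)  = convex a∈S c∈S a<b b<c
  convex-≤ convex a∈S c∈S (inj₁ a<b)  (inj₂ refl) = c∈S
  convex-≤ convex a∈S c∈S (inj₂ refl) b≤c         = a∈S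

  module _ (isSTO : IsStrictTotalOrder _≡_ _<_) where

    open IsStrictTotalOrder isSTO using (compare) renaming (trans to <-trans)

    upClosed⇒independenceDimension≤1 : ∀ {𝒜 : Pred (Pred A ℓ) ℓ} →
      (∀ {B} → B ∈ 𝒜 → UpClosed B) → IndependenceDimension≤1 𝒜
    upClosed⇒independenceDimension≤1 up (B₀ , B₁ , B₀∈𝒜 , B₁∈𝒜 , _ , sat)
      -- Of a point in each difference, the smaller one forces the larger into its own set.
      with sat true false | sat false true
    ... | a , a∈B₀ , a∉B₁ | b , b∉B₀ , b∈B₁ with compare a b
    ... | tri< a<b _ _  = b∉B₀ (up B₀∈𝒜 a<b a∈B₀)
    ... | tri≈ _ refl _ = b∉B₀ a∈B₀
    ... | tri> _ _ b<a  = a∉B₁ (up B₁∈𝒜 b<a b∈B₁)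

    ≤-trans : ∀ {x y z} → x ≤ y → y ≤ z → x ≤ z
    ≤-trans = mk≤-trans isEquivalence (resp₂ _<_) <-trans

    alternation-up : ∀ S k {x y} → x ≤ y → Alternation S k x → Alternation S k y
    alternation-up S zero    x≤y _                = tt
    alternation-up S (suc k) x≤y (z , z≤x , rest) = z , ≤-trans z≤x x≤y , rest

    alternation-pred : ∀ S k {x} → Alternation S (suc k) x → Alternation S k x
    alternation-pred S k (z , z≤x , _ , alt) = alternation-up S k z≤x alt

    alternation-antitone : ∀ S {j k x} → j ≤′ k → Alternation S k x → Alternation S j x
    alternation-antitone S ≤′-refl             alt = alt
    alternation-antitone S (≤′-step {k} j≤k)  alt =
      alternation-antitone S j≤k (alternation-pred S k alt)

    module _ (em : ∀ {a} → ExcludedMiddle a) where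

      ∁^-even : ∀ (S : Pred A ℓ) k → ∁^ (k * 2) S ⊆ S
      ∁^-even S zero    = id
      ∁^-even S (suc k) = ∁^-even S k ∘ decidable-stable em

      ∁^-odd : ∀ (S : Pred A ℓ) k → ∁^ (suc (k * 2)) S ⊆ ∁ S
      ∁^-odd S zero    = id
      ∁^-odd S (suc k) = ∁^-odd S k ∘ decidable-stable em

      -- A point z of S lies in some C i; once the alternation has left S below
      -- z, convexity makes C i useless for the rest of it.
      ¬alternation-convex : ∀ S k (C : Fin k → Pred A ℓ) → (∀ i → Convex _<_ (C i)) →
        (∀ i → C i ⊆ S) → ∀ x → (∀ {y} → y ≤ x → y ∈ S → y ∈ ⋃ (Fin k) C) →
        ¬ Alternation S (suc (k * 2)) x
      ¬alternation-convex S zero C convex C⊆S x cover (z , z≤x , z∈S , _)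
        with () ← proj₁ (cover z≤x z∈S)
      ¬alternation-convex S (suc k) C convex C⊆S x cover
        (z , z≤x , z∈S , w , w≤z , w∉S , alt)
        with cover z≤x (∁^-even S (suc k) z∈S)
      -- `z` and `w` use up two points and one convex set, so `suc (k * 2)` points below `w` face
      -- `k` sets.
      ... | i , z∈Cᵢ = ¬alternation-convex S k (C ∘ punchIn i) (convex ∘ punchIn i)
        (λ j → C⊆S (punchIn i j)) w cover′ alt
        where
        w∉S′ : w ∉ S
        w∉S′ = ∁^-odd S k w∉S

        -- Otherwise `w` would lie between two points of `C i`, hence in `S`.
        y≤w⇒y∉Cᵢ : ∀ {y} → y ≤ w → y ∉ C i
        y≤w⇒y∉Cᵢ y≤w y∈Cᵢ = w∉S′ (C⊆S i (convex-≤ {C i} (convex i) y∈Cᵢ z∈Cᵢ y≤w w≤z))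

        cover′ : ∀ {y} → y ≤ w → y ∈ S → y ∈ ⋃ (Fin k) (C ∘ punchIn i)
        cover′ {y} y≤w y∈S with cover (≤-trans y≤w (≤-trans w≤z z≤x)) y∈S
        ... | j , y∈Cⱼ = punchOut i≢j , subst (λ j → y ∈ C j) (sym (punchIn-punchOut i≢j)) y∈Cⱼ
          where
          i≢j : ¬ i ≡ j
          i≢j refl = y≤w⇒y∉Cᵢ y≤w y∈Cⱼ

      finiteUnion⇒¬alternation : ∀ {S} → FiniteUnionOfConvex _<_ S →
        ∀ x → ∃[ k ] ¬ Alternation S k x
      finiteUnion⇒¬alternation {S} (k , C , convex , S⊆C , C⊆S) x =
        suc (k * 2) ,
        ¬alternation-convex S k C convex (λ i y∈Cᵢ → C⊆S (i , y∈Cᵢ)) x (λ _ → S⊆C)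

-- Alternations as formulas

¬ᶠ^ : ℕ → Formula L n → Formula L n
¬ᶠ^ zero    φ = φ
¬ᶠ^ (suc k) φ = ¬ᶠ ¬ᶠ^ k φ

module _ {L : Language ℓ} (lt : RelSym L 2) where

  lessᴵ : (M : Structure L) → Rel (Carrier M) ℓ
  lessᴵ M a b = relᴵ M lt (a ∷ b ∷ [])

  alternationᶠ : Formula L (1 + m) → ℕ → Formula L (1 + m)
  alternationᶠ φ zero    = var zero ≈ᶠ var zero
  alternationᶠ φ (suc k) = ∃ᶠ
    ((rel lt (var zero ∷ var (suc zero) ∷ []) ∨ᶠ var zero ≈ᶠ var (suc zero)) ∧ᶠ
     -- The bound `z` takes over the role of `x`: `lift 1 suc` fixes index 0 and skips the old `x`
     -- at index 1.
     rename (lift 1 suc) (¬ᶠ^ k φ) ∧ᶠ rename (lift 1 suc) (alternationᶠ φ k))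

  -- If no alternation reaches length n + k, this is equivalent to ¬ᶠ^ k φ at
  -- the points above an alternation of length k.  At n = 0 there is no such
  -- point, and the formula is irrelevant.
  nestedAlternations : Formula L (1 + m) → ℕ → ℕ → Formula L (1 + m)
  nestedAlternations φ zero    k = alternationᶠ φ (suc k)
  nestedAlternations φ (suc n) k =
    alternationᶠ φ (suc k) ∧ᶠ ¬ᶠ nestedAlternations φ n (suc k)

  nestedAlternations-booleanCombination : {Ψ : Family} (φ : Formula L (1 + m)) →
    (∀ k → Ψ (alternationᶠ φ k)) → ∀ n k → BooleanCombination Ψ (nestedAlternations φ n k)
  nestedAlternations-booleanCombination φ alt∈Ψ zero    k = atom (alt∈Ψ (suc k))
  nestedAlternations-booleanCombination φ alt∈Ψ (suc n) k =
    conj (atom (alt∈Ψ (suc k))) (neg (nestedAlternations-booleanCombination φ alt∈Ψ n (suc k)))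

  module _ (M : Structure L) where

    private
      _<_ = lessᴵ M

    ⊨-¬ᶠ^ : (φ : Formula L (1 + m)) (k : ℕ) {x : Carrier M} {b : Vec (Carrier M) m} →
            M ⊨ ¬ᶠ^ k φ [ x ∷ b ] ⇔ ∁^ k (⟦ φ ⟧ M b) x
    ⊨-¬ᶠ^ φ zero    = ⇔-refl
    ⊨-¬ᶠ^ φ (suc k) = ¬-⇔ (⊨-¬ᶠ^ φ k)

    ⊨-alternationᶠ : (φ : Formula L (1 + m)) (k : ℕ) {x : Carrier M} {b : Vec (Carrier M) m} →
      M ⊨ alternationᶠ φ k [ x ∷ b ] ⇔ Alternation _<_ (⟦ φ ⟧ M b) k x
    ⊨-alternationᶠ φ zero    = mk⇔ (λ _ → tt) (λ _ → refl)
    ⊨-alternationᶠ φ (suc k) {x} {b} = ∃-⇔ λ z →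
      ⇔-refl ×-⇔
      (⇔-trans (⊨-rename M (skip z) (¬ᶠ^ k φ)) (⊨-¬ᶠ^ φ k) ×-⇔
       ⇔-trans (⊨-rename M (skip z) (alternationᶠ φ k)) (⊨-alternationᶠ φ k))
      where
      skip : ∀ z i → lookup (z ∷ x ∷ b) (lift 1 suc i) ≡ lookup (z ∷ b) i
      skip z = lookup-lift M (λ _ → refl) z

    module _ (em : ∀ {a} → ExcludedMiddle a) (φ : Formula L (1 + m))
             {x : Carrier M} {b : Vec (Carrier M) m} where

      private
        S : Pred (Carrier M) ℓ
        S = ⟦ φ ⟧ M b

      -- Induction on the room `n` left under the bound. If `x` is in `∁^ k S`, it prolongs the
      -- given alternation by itself. Once length `suc k` is reached, the inner formula expresses
      -- the complement of `∁^ k S`, and negating it gives `∁^ k S` back.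
      ⊨-nestedAlternations : ∀ n k → ¬ Alternation _<_ S (n + k) x → Alternation _<_ S k x →
        ∁^ k S x ⇔ M ⊨ nestedAlternations φ n k [ x ∷ b ]
      ⊨-nestedAlternations zero    k bound alt = contradiction alt bound
      ⊨-nestedAlternations (suc n) k bound alt = mk⇔
        (λ x∈S → from (⊨-alternationᶠ φ (suc k)) (extend x∈S) ,
                 λ nested → from (next (extend x∈S)) nested x∈S)
        (λ (alt′ , ¬nested) → decidable-stable em
          (¬nested ∘ to (next (to (⊨-alternationᶠ φ (suc k)) alt′))))
        where
        extend : ∁^ k S x → Alternation _<_ S (suc k) x
        extend x∈S = x , inj₂ refl , x∈S , alt

        next : Alternation _<_ S (suc k) x →
               ∁^ (suc k) S x ⇔ M ⊨ nestedAlternations φ n (suc k) [ x ∷ b ]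
        next = ⊨-nestedAlternations n (suc k)
          (subst (λ j → ¬ Alternation _<_ S j x) (sym (ℕ.+-suc n k)) bound)

  -- Up-closed formulas and the uniform bound on alternations

  UpClosedFormulas : Structure L → Family {L = L}
  UpClosedFormulas M ψ = ∀ b → UpClosed (lessᴵ M) (⟦ ψ ⟧ M b)

  instances-upClosed : ∀ M {B} → B ∈ Instances (UpClosedFormulas M) M → UpClosed (lessᴵ M) B
  instances-upClosed M (_ , ψ , up , b , B⊆ψ , ψ⊆B) a<c = ψ⊆B ∘ up b a<c ∘ B⊆ψ

  alternationᶠ-upClosed : ∀ M → IsStrictTotalOrder _≡_ (lessᴵ M) →
    (φ : Formula L (1 + m)) (k : ℕ) → UpClosedFormulas M (alternationᶠ φ k)
  alternationᶠ-upClosed M isSTO φ k b a<c =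
    from (⊨-alternationᶠ M φ k) ∘
    alternation-up (lessᴵ M) isSTO (⟦ φ ⟧ M b) k (inj₁ a<c) ∘
    to (⊨-alternationᶠ M φ k)

  module _ (em : ∀ {a} → ExcludedMiddle a) {T : Theory L} {ℭ : Structure L}
           (monster : Monster T ℭ) (isSTO : IsStrictTotalOrder _≡_ (lessᴵ ℭ))
           (definable⇒finiteUnion : ∀ S → Definable ℭ S → FiniteUnionOfConvex (lessᴵ ℭ) S)
           where

    -- Compactness in `x` and the parameters jointly: without a bound, a single tuple would carry
    -- alternations of every length, although its instance of `φ` is a finite union of convex sets.
    alternation-bound : (φ : Formula L (1 + m)) →
      ∃[ k ] (∀ v → ¬ ℭ ⊨ alternationᶠ φ k [ v ])
    alternation-bound {m} φ with em {P = ∃[ k ] (∀ v → ¬ ℭ ⊨ alternationᶠ φ k [ v ])}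
    ... | yes bound = bound
    ... | no ¬bound with monster-realizes monster (alternationᶠ φ) finSat
      where
      finSat : FinitelySatisfiableᶠ ℭ (alternationᶠ φ)
      -- Since `k` is no bound, some tuple has an alternation of length `k`; its truncations satisfy
      -- the earlier formulas.
      finSat k with decidable-stable em (λ ¬∃ → ¬bound (k , λ v alt → ¬∃ (v , alt)))
      ... | x ∷ b , alt = x ∷ b , λ j≤k → from (⊨-alternationᶠ ℭ φ _)
        (alternation-antitone (lessᴵ ℭ) isSTO _ j≤k (to (⊨-alternationᶠ ℭ φ k) alt))
    ... | x ∷ b , alts with finiteUnion⇒¬alternation (lessᴵ ℭ) isSTO em
            (definable⇒finiteUnion (⟦ φ ⟧ ℭ b) (m , φ , b , id , id)) x
    ... | k , ¬alt = contradiction (to (⊨-alternationᶠ ℭ φ k) (alts k)) ¬alt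

proposition3p11 : (∀ {a} → ExcludedMiddle a) →
    ∀ {ℓ} (L : Language ℓ) (T : Theory L) → Complete T →
    (ℭ : Structure L) → Monster T ℭ →
    WeaklyOMinimal T → FullyVCMinimal T ℭ
proposition3p11 em L T complete ℭ monster (lt , wom) =
  UpClosedFormulas lt ℭ ,
  upClosed⇒independenceDimension≤1 _ isSTO (instances-upClosed lt ℭ) ,
  combination
  where
  open Monster monster using (isModel)

  isSTO : IsStrictTotalOrder _≡_ (lessᴵ lt ℭ)
  isSTO = proj₁ (wom ℭ isModel)

  combination : ∀ {m} (φ : Formula L (1 + m)) → Σ[ ψ ∈ Formula L (1 + m) ]
    (BooleanCombination (UpClosedFormulas lt ℭ) ψ × Equivalent T φ ψ)
  combination φ with alternation-bound lt em monster isSTO (proj₂ (wom ℭ isModel)) φ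
  ... | k , bound =
    -- Starting at length 0, `∁^ 0` is the set itself and the required alternation is trivial; the
    -- depth is the bound.
    nestedAlternations lt φ k 0 ,
    nestedAlternations-booleanCombination lt φ (alternationᶠ-upClosed lt ℭ isSTO φ) k 0 ,
    equivalent
    where
    equivalent : Equivalent T φ (nestedAlternations lt φ k 0)
    equivalent M M⊨T (x ∷ b) = ⊨-nestedAlternations lt M em φ k 0
      (subst (λ j → ¬ Alternation _ _ j x) (sym (ℕ.+-identityʳ k))
        -- The bound is a formula valid in `ℭ`, so completeness carries it to `M`.
        (complete-transfer complete isModel M⊨T (¬ᶠ alternationᶠ lt φ k) bound (x ∷ b) ∘
         from (⊨-alternationᶠ lt M φ k)))
      tt
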